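{- No finite family of generalised chromatic polynomials is a complete graph invariant; that is, for every finite family of graphs $H_1,\dots,H_t$ there exist non-isomorphic graphs $G$ and $G'$ such that $\pi^{(H_i)}_G = \pi^{(H_i)}_{G'}$ (as functions of the number of colours $k$) for every $i\in\{1,\dots,t\}$.
   Context: All graphs are finite and simple. For a positive integer $k$, a $k$-colouring of a graph $G$ is a proper colouring $c\colon V(G)\to [k]=\{1,\dots,k\}$, i.e. $c(u)\neq c(v)$ whenever $uv\in E(G)$ (not all $k$ colours need be used). The $k$-colouring graph $\mathcal{C}_k(G)$ has as vertices the $k$-colourings of $G$, with an edge between two $k$-colourings if and only if they differ at precisely one vertex of $G$. For graphs $G$ and $H$, the generalised chromatic polynomial is the function $\pi^{(H)}_G$ where $\pi^{(H)}_G(k)$ is the number of subsets of $V(\mathcal{C}_k(G))$ that induce a subgraph of $\mathcal{C}_k(G)$ isomorphic to $H$. -}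

module Defs where

open import Level using (0ℓ)
open import Data.Nat using (ℕ; zero; suc)
open import Data.Fin using (Fin; _≟_)
open import Data.Fin.Properties using (all?; any?)
open import Data.Fin.Subset using (Subset; inside; outside)
open import Data.Fin.Subset.Properties using (_∈?_)
open import Data.List as List
  using (List; []; _∷_; length; filter; allFin; cartesianProductWith)
open import Data.List.Membership.Propositional using (_∈_; lose)
open import Data.List.Membership.Propositional.Properties
  using (∈-cartesianProductWith⁺; ∈-allFin)
import Data.List.Relation.Unary.All as All
import Data.List.Relation.Unary.AllPairs as AllPairs
import Data.List.Relation.Unary.Any as Any
open import Data.List.Relation.Unary.Unique.Propositional using (Unique)
open import Data.List.Relation.Unary.Unique.Propositional.Properties
  using (cartesianProductWith⁺)
open import Data.Product using (Σ-syntax; ∃; ∃!; _×_; _,_)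
open import Data.Vec using (Vec; []; _∷_; lookup; tabulate)
open import Data.Vec.Properties using (lookup∘tabulate; ∷-injective)
open import Function.Bundles using (_↔_; _⇔_; mk⇔; mk↔ₛ′; Inverse; Equivalence)
open import Relation.Binary using (Rel; Symmetric; Irreflexive)
import Relation.Binary as B
open import Relation.Binary.PropositionalEquality
  using (_≡_; _≢_; refl; sym; trans; subst; subst₂)
open import Relation.Nullary using (Dec; ¬?)
open import Relation.Nullary.Decidable using (map′; _×-dec_; _→-dec_)

-- Every finite simple graph is, up to relabelling, one on Fin order.
record Graph : Set₁ where
  field
    order      : ℕ
    Adj        : Rel (Fin order) 0ℓ
    Adj?       : B.Decidable Adj
    Adj-sym    : Symmetric Adj
    Adj-irrefl : Irreflexive _≡_ Adj

open Graph public

V : Graph → Set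
V G = Fin (order G)

infix 4 _≅_ _≅?_

_≅_ : Graph → Graph → Set
G ≅ H = Σ[ φ ∈ V G ↔ V H ]
  (∀ u v → Adj G u v ⇔ Adj H (Inverse.to φ u) (Inverse.to φ v))

-- All vectors of length n with entries in xs; by the two lemmas below, each
-- occurs exactly once when xs lists a type completely and without repetition.
vecs : {A : Set} → List A → ∀ n → List (Vec A n)
vecs xs zero    = [] ∷ []
vecs xs (suc n) = cartesianProductWith _∷_ xs (vecs xs n)

vecs-complete : {A : Set} {xs : List A} → (∀ x → x ∈ xs) →
                ∀ {n} (v : Vec A n) → v ∈ vecs xs n
vecs-complete all∈ []      = Any.here refl
vecs-complete all∈ (x ∷ v) =
  ∈-cartesianProductWith⁺ _∷_ (all∈ x) (vecs-complete all∈ v)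

vecs-unique : {A : Set} {xs : List A} → Unique xs → ∀ n → Unique (vecs xs n)
vecs-unique xs! zero    = All.[] AllPairs.∷ AllPairs.[]
vecs-unique xs! (suc n) =
  cartesianProductWith⁺ _∷_ ∷-injective xs! (vecs-unique xs! n)

subsets : ∀ n → List (Subset n)
subsets = vecs (outside ∷ inside ∷ [])

any-vec? : ∀ {m n} {P : Vec (Fin m) n → Set} → (∀ v → Dec (P v)) → Dec (∃ P)
any-vec? P? = map′ Any.satisfied (λ (v , p) → lose (vecs-complete ∈-allFin v) p)
  (Any.any? P? (vecs (allFin _) _))

_≅?_ : ∀ G H → Dec (G ≅ H)
G ≅? H = map′ to from
  (any-vec? λ t → any-vec? λ f →
    all? (λ y → lookup t (lookup f y) ≟ y) ×-dec
    all? (λ x → lookup f (lookup t x) ≟ x) ×-dec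
    all? (λ u → all? λ v →
      (Adj? G u v →-dec Adj? H (lookup t u) (lookup t v)) ×-dec
      (Adj? H (lookup t u) (lookup t v) →-dec Adj? G u v)))
  where
  Code : Set
  Code = ∃ λ (t : Vec (V H) (order G)) → ∃ λ (f : Vec (V G) (order H)) →
    (∀ y → lookup t (lookup f y) ≡ y) ×
    (∀ x → lookup f (lookup t x) ≡ x) ×
    (∀ u v → (Adj G u v → Adj H (lookup t u) (lookup t v)) ×
             (Adj H (lookup t u) (lookup t v) → Adj G u v))

  to : Code → G ≅ H
  to (t , f , tf , ft , adj) =
    mk↔ₛ′ (lookup t) (lookup f) tf ft ,
    λ u v → let (p , q) = adj u v in mk⇔ p q

  from : G ≅ H → Code
  from (φ , adj) = tabulate φ.to , tabulate φ.from ,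
    (λ y → trans (t≗ _) (φ.inverseˡ (f≗ y))) ,
    (λ x → trans (f≗ _) (φ.inverseʳ (t≗ x))) ,
    λ u v → (λ a → subst₂ (Adj H) (sym (t≗ u)) (sym (t≗ v))
                     (Equivalence.to (adj u v) a)) ,
            (λ b → Equivalence.from (adj u v)
                     (subst₂ (Adj H) (t≗ u) (t≗ v) b))
    where
    module φ = Inverse φ
    t≗ = lookup∘tabulate φ.to
    f≗ = lookup∘tabulate φ.from

-- The i-th vertex of the induced subgraph is the i-th smallest element of S.
members : ∀ {n} → Subset n → List (Fin n)
members S = filter (_∈? S) (allFin _)

infix 5 _[_]

_[_] : (G : Graph) → Subset (order G) → Graph
G [ S ] = record
  { order      = length (members S)
  ; Adj        = λ i j → Adj G (v i) (v j)
  ; Adj?       = λ i j → Adj? G (v i) (v j)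
  ; Adj-sym    = Adj-sym G
  ; Adj-irrefl = λ { refl → Adj-irrefl G refl }
  }
  where v = List.lookup (members S)

#induced : Graph → Graph → ℕ
#induced H Γ = length (filter (λ S → Γ [ S ] ≅? H) (subsets (order Γ)))

Proper : (G : Graph) {k : ℕ} → Vec (Fin k) (order G) → Set
Proper G c = ∀ u v → Adj G u v → lookup c u ≢ lookup c v

proper? : ∀ G {k} (c : Vec (Fin k) (order G)) → Dec (Proper G c)
proper? G c = all? λ u → all? λ v →
  Adj? G u v →-dec ¬? (lookup c u ≟ lookup c v)

colourings : (G : Graph) (k : ℕ) → List (Vec (Fin k) (order G))
colourings G k = filter (proper? G) (vecs (allFin k) (order G))

DifferAtOne : ∀ {k n} → Rel (Vec (Fin k) n) 0ℓ
DifferAtOne c d = ∃! _≡_ λ v → lookup c v ≢ lookup d v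

differAtOne? : ∀ {k n} → B.Decidable (DifferAtOne {k} {n})
differAtOne? c d = any? λ v →
  ¬? (lookup c v ≟ lookup d v) ×-dec
  map′ (λ f {w} → f w) (λ f w → f {w})
    (all? λ w → ¬? (lookup c w ≟ lookup d w) →-dec (v ≟ w))

-- Vertex i stands for the i-th entry of colourings G k.
𝒞 : ℕ → Graph → Graph
𝒞 k G = record
  { order      = length (colourings G k)
  ; Adj        = λ i j → DifferAtOne (c i) (c j)
  ; Adj?       = λ i j → differAtOne? (c i) (c j)
  ; Adj-sym    = λ (v , v≢ , v!) →
      v , (λ eq → v≢ (sym eq)) , λ w≢ → v! (λ eq → w≢ (sym eq))
  ; Adj-irrefl = λ { refl (_ , v≢ , _) → v≢ refl }
  }
  where c = List.lookup (colourings G k)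

-- π H G k is π_G^{(H)}(k).
π : Graph → Graph → ℕ → ℕ
π H G k = #induced H (𝒞 k G)

{-# OPTIONS --safe #-}
module Submission where

-- Attach L gadgets to a hub, gadget i being a path on three vertices whose root
-- is joined to the hub and is an end or the centre of the path according to a
-- bit y i. Take one component for every y ∈ {0,1}^L and join all the roots of a
-- component into a clique when y has parity p; G and G′ are the graphs for the
-- two values of p.
-- For each i, flipping the i-th bit and repairing the colours at gadget i alone
-- is a bijection between the k-colourings of G and those of G′. It respects
-- adjacency of two colourings unless they differ exclusively inside gadget i, and
-- it respects, for every j, whether they differ exclusively inside gadget j. A set
-- of |H| colourings has at most |H|² pairs, each spoiling at most one gadget,
-- so if L > |H|² some gadget is unspoilt; switching at the first unspoilt gadget
-- is a bijection between the induced copies of H in the two colouring graphs.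

open import Defs
open import Data.Bool using (Bool; true; false; not; _xor_; if_then_else_)
open import Data.Bool.Properties using (not-involutive; not-¬) renaming (_≟_ to _≟ᵇ_)
open import Data.Empty using (⊥)
open import Data.Nat using (ℕ; zero; suc; NonZero; _≤_; _<_; _*_; _⊔_; s≤s)
open import Data.Nat.Properties
  using (≤-antisym; ≤-trans; *-mono-≤; m≤m⊔n; m≤n⊔m; m≤n⇒m≤1+n)
open import Data.Fin using (Fin; zero; suc; combine; _≟_)
open import Data.Fin.Patterns using (0F; 1F; 2F)
open import Data.Fin.Permutation using (↔⇒≡)
open import Data.Fin.Permutation.Components using (transpose)
open import Data.Fin.Properties
  using (all?; any?; pigeonhole; injective⇒≤; ¬∀⟶∃¬; combine-injective; <⇒≢)
open import Data.Fin.Subset using (Subset)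
open import Data.Fin.Subset.Properties using () renaming (_∈?_ to _∈ˢ?_)
open import Data.List as List using (List; []; _∷_; length; allFin; cartesianProduct)
open import Data.List.Membership.Propositional using (_∈_)
open import Data.List.Membership.Propositional.Properties
  using (∈-lookup; ∈-filter⁺; ∈-filter⁻; ∈-allFin; ∈-map⁺; ∈-cartesianProduct⁺)
import Data.List.Relation.Unary.All as All
import Data.List.Relation.Unary.All.Properties as All
import Data.List.Relation.Unary.AllPairs as AllPairs
open import Data.List.Relation.Unary.Any using (here; there; index)
open import Data.List.Relation.Unary.Any.Properties using (lookup-index)
open import Data.List.Relation.Unary.Unique.Propositional using (Unique)
open import Data.List.Relation.Unary.Unique.Propositional.Properties
  using (filter⁺; allFin⁺; map⁺; cartesianProduct⁺)
open import Data.Maybe using (Maybe; just; nothing)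
open import Data.Maybe.Properties using (just-injective)
open import Data.Product using (∃; ∃₂; Σ-syntax; _×_; _,_; proj₁; proj₂)
open import Data.Sum using (_⊎_; inj₁; inj₂; swap)
open import Data.Vec using (Vec; []; _∷_; lookup; tabulate; updateAt; replicate)
open import Data.Vec.Properties
  using (lookup∘tabulate; tabulate∘lookup; tabulate-cong; []=⇒lookup; lookup⇒[]=;
         lookup∘updateAt; lookup∘updateAt′; updateAt-updateAt; updateAt-id-local;
         lookup-replicate; ≡-dec)
open import Function.Base using (_∘_; id)
open import Function.Bundles using (_↔_; _⇔_; mk⇔; mk↔ₛ′; Inverse; Equivalence)
open import Function.Construct.Composition using (_↔-∘_; _⇔-∘_)
open import Function.Construct.Symmetry using (↔-sym; ⇔-sym)
open import Relation.Binary.PropositionalEquality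
  using (_≡_; _≢_; refl; sym; trans; cong; subst; subst₂; module ≡-Reasoning)
open import Relation.Nullary using (¬_; Dec; yes; no; does; ¬?; contradiction)
open import Relation.Nullary.Decidable
  using (_×-dec_; _⊎-dec_; _→-dec_; map′; dec-true; dec-false; does-⇔; decidable-stable)

-- Positions in lists without repetition.

lookup-injective : {A : Set} {xs : List A} → Unique xs →
                   ∀ {i j} → List.lookup xs i ≡ List.lookup xs j → i ≡ j
lookup-injective (_ AllPairs.∷ _) {zero} {zero} _ = refl
lookup-injective (x∉ AllPairs.∷ _) {zero} {suc j} eq =
  contradiction eq (All.lookup x∉ (∈-lookup j))
lookup-injective (x∉ AllPairs.∷ _) {suc i} {zero} eq =
  contradiction (sym eq) (All.lookup x∉ (∈-lookup i))
lookup-injective (_ AllPairs.∷ xs!) {suc i} {suc j} eq =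
  cong suc (lookup-injective xs! eq)

module _ {A B : Set} {xs : List A} {ys : List B} (xs! : Unique xs) (ys! : Unique ys)
         (f : A → B) (f∈ : ∀ {x} → x ∈ xs → f x ∈ ys) where

  private
    pos : Fin (length xs) → Fin (length ys)
    pos i = index (f∈ (∈-lookup i))

    lookup-pos : ∀ i → List.lookup ys (pos i) ≡ f (List.lookup xs i)
    lookup-pos i = sym (lookup-index (f∈ (∈-lookup i)))

  length-≤ : (g : B → A) → (∀ {x} → x ∈ xs → g (f x) ≡ x) → length xs ≤ length ys
  length-≤ g gf = injective⇒≤ {f = pos} λ {i} {j} eq → lookup-injective xs! (begin
    List.lookup xs i           ≡⟨ gf (∈-lookup i) ⟨
    g (f (List.lookup xs i))   ≡⟨ cong g (lookup-pos i) ⟨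
    g (List.lookup ys (pos i)) ≡⟨ cong (λ a → g (List.lookup ys a)) eq ⟩
    g (List.lookup ys (pos j)) ≡⟨ cong g (lookup-pos j) ⟩
    g (f (List.lookup xs j))   ≡⟨ gf (∈-lookup j) ⟩
    List.lookup xs j           ∎)
    where open ≡-Reasoning

  -- Positions in such lists are the vertices of both `_[_]` and `𝒞`, so bijections of members and
  -- of colourings enter the graphs through this.
  lookup-↔ : (g : B → A) → (∀ {y} → y ∈ ys → g y ∈ xs) →
             (∀ {x} → x ∈ xs → g (f x) ≡ x) → (∀ {y} → y ∈ ys → f (g y) ≡ y) →
             Σ[ ψ ∈ Fin (length xs) ↔ Fin (length ys) ]
               (∀ i → List.lookup ys (Inverse.to ψ i) ≡ f (List.lookup xs i))
  lookup-↔ g g∈ gf fg = mk↔ₛ′ pos back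
      (λ j → lookup-injective ys! (trans (lookup-pos (back j))
               (trans (cong f (lookup-back j)) (fg (∈-lookup j)))))
      (λ i → lookup-injective xs! (trans (lookup-back (pos i))
               (trans (cong g (lookup-pos i)) (gf (∈-lookup i)))))
    , lookup-pos
    where
    back : Fin (length ys) → Fin (length xs)
    back j = index (g∈ (∈-lookup j))

    lookup-back : ∀ j → List.lookup xs (back j) ≡ g (List.lookup ys j)
    lookup-back j = sym (lookup-index (g∈ (∈-lookup j)))

-- Subsets and isomorphisms of induced subgraphs.

members! : ∀ {n} (S : Subset n) → Unique (members S)
members! S = filter⁺ (_∈ˢ? S) (allFin⁺ _)

∈-members : ∀ {n} {S : Subset n} {x} → lookup S x ≡ true → x ∈ members S
∈-members {S = S} {x} x∈S = ∈-filter⁺ (_∈ˢ? S) (∈-allFin x) (lookup⇒[]= x S x∈S)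

members-∈ : ∀ {n} {S : Subset n} {x} → x ∈ members S → lookup S x ≡ true
members-∈ {S = S} x∈ = []=⇒lookup (proj₂ (∈-filter⁻ (_∈ˢ? S) {xs = allFin _} x∈))

bools! : Unique (false ∷ true ∷ [])
bools! = ((λ ()) All.∷ All.[]) AllPairs.∷ All.[] AllPairs.∷ AllPairs.[]

∈-bools : ∀ b → b ∈ false ∷ true ∷ []
∈-bools false = here refl
∈-bools true  = there (here refl)

subsets! : ∀ n → Unique (subsets n)
subsets! = vecs-unique bools!

∈-subsets : ∀ {n} (S : Subset n) → S ∈ subsets n
∈-subsets = vecs-complete ∈-bools

-- Adjacency is compared on `S` alone, because a switching bijection need not be an isomorphism of
-- the whole graphs.
induced-≅ : ∀ {Γ Δ} (ψ : V Γ ↔ V Δ) (S : Subset (order Γ)) (T : Subset (order Δ)) →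
            (∀ u → lookup T (Inverse.to ψ u) ≡ lookup S u) →
            (∀ {u v} → lookup S u ≡ true → lookup S v ≡ true →
             Adj Γ u v ⇔ Adj Δ (Inverse.to ψ u) (Inverse.to ψ v)) →
            (Γ [ S ]) ≅ (Δ [ T ])
induced-≅ {Γ} {Δ} ψ S T eq adj = let (χ , χ≡) = correspondence in χ , λ i j →
  subst₂ (λ u v → Adj Γ (List.lookup (members S) i) (List.lookup (members S) j) ⇔ Adj Δ u v)
    (sym (χ≡ i)) (sym (χ≡ j))
    (adj (members-∈ {S = S} (∈-lookup i)) (members-∈ {S = S} (∈-lookup j)))
  where
  module ψ = Inverse ψ
  correspondence = lookup-↔ (members! S) (members! T) ψ.to
    (λ x∈ → ∈-members (trans (eq _) (members-∈ x∈))) ψ.from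
    (λ {y} y∈ → ∈-members (trans (sym (eq (ψ.from y)))
      (trans (cong (lookup T) (ψ.strictlyInverseˡ y)) (members-∈ y∈))))
    (λ _ → ψ.strictlyInverseʳ _) (λ _ → ψ.strictlyInverseˡ _)

≅-sym : ∀ {G H} → G ≅ H → H ≅ G
≅-sym {G} {H} (φ , adj) = ↔-sym φ , λ u v →
  subst₂ (λ a b → Adj H a b ⇔ Adj G (φ.from u) (φ.from v))
    (φ.strictlyInverseˡ u) (φ.strictlyInverseˡ v) (⇔-sym (adj _ _))
  where module φ = Inverse φ

≅-trans : ∀ {G H K} → G ≅ H → H ≅ K → G ≅ K
≅-trans (φ , φ-adj) (χ , χ-adj) = χ ↔-∘ φ , λ u v → χ-adj _ _ ⇔-∘ φ-adj u v

-- Switching at the first unspoilt gadget.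

-- Returns the last index when every entry is true.
firstFalse : ∀ {m} → Vec Bool (suc m) → Fin (suc m)
firstFalse {zero}  _           = zero
firstFalse {suc m} (false ∷ _) = zero
firstFalse {suc m} (true ∷ v)  = suc (firstFalse v)

-- A false entry excludes the default value: a search that reaches the last index has passed only
-- true entries.
firstFalse-false : ∀ {m} (v : Vec Bool (suc m)) {i} → lookup v i ≡ false →
                   lookup v (firstFalse v) ≡ false
firstFalse-false {zero}  _           {zero}  eq = eq
firstFalse-false {suc m} (false ∷ _)         _  = refl
firstFalse-false {suc m} (true ∷ v)  {suc i} eq = firstFalse-false v eq

-- Near i u v stands for: the colourings u and v agree outside gadget i.
record Switching (L : ℕ) (Γ Δ : Graph) : Set₁ where
  field
    ψ      : Fin L → V Γ ↔ V Δ
    NearΓ  : Fin L → V Γ → V Γ → Set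
    NearΔ  : Fin L → V Δ → V Δ → Set
    nearΓ? : ∀ i u v → Dec (NearΓ i u v)
    nearΔ? : ∀ i u v → Dec (NearΔ i u v)
    near   : ∀ i j u v →
             NearΓ j u v ⇔ NearΔ j (Inverse.to (ψ i) u) (Inverse.to (ψ i) v)
    apart  : ∀ {i j u v} → i ≢ j → NearΓ i u v → NearΓ j u v → u ≡ v
    adj    : ∀ i {u v} → ¬ NearΓ i u v →
             Adj Γ u v ⇔ Adj Δ (Inverse.to (ψ i) u) (Inverse.to (ψ i) v)

module _ {n : ℕ} (Near : Fin n → Fin n → Set) (S : Subset n) where

  -- This is how `S` spoils a gadget: switching there may change whether such a pair is adjacent.
  Clash : Set
  Clash = ∃₂ λ u v → lookup S u ≡ true × lookup S v ≡ true × u ≢ v × Near u v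

  clash? : (∀ u v → Dec (Near u v)) → Dec Clash
  clash? near? = any? λ u → any? λ v →
    lookup S u ≟ᵇ true ×-dec lookup S v ≟ᵇ true ×-dec ¬? (u ≟ v) ×-dec near? u v

module _ {m : ℕ} {Γ Δ : Graph} (sw : Switching (suc m) Γ Δ) where
  open Switching sw

  private
    module ψ i = Inverse (ψ i)

    clashΓ? : ∀ S j → Dec (Clash (NearΓ j) S)
    clashΓ? S j = clash? (NearΓ j) S (nearΓ? j)

    clashΔ? : ∀ T j → Dec (Clash (NearΔ j) T)
    clashΔ? T j = clash? (NearΔ j) T (nearΔ? j)

    clashesΓ : Subset (order Γ) → Vec Bool (suc m)
    clashesΓ S = tabulate λ j → does (clashΓ? S j)

    clashesΔ : Subset (order Δ) → Vec Bool (suc m)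
    clashesΔ T = tabulate λ j → does (clashΔ? T j)

    image : Fin (suc m) → Subset (order Γ) → Subset (order Δ)
    image i S = tabulate λ w → lookup S (ψ.from i w)

    preimage : Fin (suc m) → Subset (order Δ) → Subset (order Γ)
    preimage i T = tabulate λ u → lookup T (ψ.to i u)

    lookup-image : ∀ i S u → lookup (image i S) (ψ.to i u) ≡ lookup S u
    lookup-image i S u =
      trans (lookup∘tabulate _ (ψ.to i u)) (cong (lookup S) (ψ.strictlyInverseʳ i u))

    preimage-image : ∀ i S → preimage i (image i S) ≡ S
    preimage-image i S = trans (tabulate-cong (lookup-image i S)) (tabulate∘lookup S)

    -- Switching at `i` preserves `Near j` for every `j`, so the record of clashes is invariant and
    -- `unswitch` recovers from it the gadget at which `switch` acted.
    clashes-image : ∀ i S → clashesΔ (image i S) ≡ clashesΓ S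
    clashes-image i S = tabulate-cong λ j → does-⇔ (mk⇔ (backward j) (forward j))
                                                     (clashΔ? (image i S) j) (clashΓ? S j)
      where
      forward : ∀ j → Clash (NearΓ j) S → Clash (NearΔ j) (image i S)
      forward j (u , v , u∈ , v∈ , u≢v , nr) =
        ψ.to i u , ψ.to i v ,
        trans (lookup-image i S u) u∈ , trans (lookup-image i S v) v∈ ,
        (λ eq → u≢v (trans (sym (ψ.strictlyInverseʳ i u))
                       (trans (cong (ψ.from i) eq) (ψ.strictlyInverseʳ i v)))) ,
        Equivalence.to (near i j u v) nr

      backward : ∀ j → Clash (NearΔ j) (image i S) → Clash (NearΓ j) S
      backward j (u , v , u∈ , v∈ , u≢v , nr) =
        ψ.from i u , ψ.from i v ,
        trans (sym (lookup∘tabulate _ u)) u∈ , trans (sym (lookup∘tabulate _ v)) v∈ ,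
        (λ eq → u≢v (trans (sym (ψ.strictlyInverseˡ i u))
                       (trans (cong (ψ.to i) eq) (ψ.strictlyInverseˡ i v)))) ,
        Equivalence.from (near i j _ _)
          (subst₂ (NearΔ j) (sym (ψ.strictlyInverseˡ i u)) (sym (ψ.strictlyInverseˡ i v)) nr)

    switch : Subset (order Γ) → Subset (order Δ)
    switch S = image (firstFalse (clashesΓ S)) S

    unswitch : Subset (order Δ) → Subset (order Γ)
    unswitch T = preimage (firstFalse (clashesΔ T)) T

    -- This covers sets that spoil every gadget too: equal clash records give the same default index
    -- on both sides.
    unswitch-switch : ∀ S → unswitch (switch S) ≡ S
    unswitch-switch S = trans
      (cong (λ i → preimage (firstFalse i) (switch S)) (clashes-image (firstFalse (clashesΓ S)) S))
      (preimage-image (firstFalse (clashesΓ S)) S)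

    -- Each pair of members of S clashes in at most one gadget, and there are more
    -- gadgets than pairs.
    clash-free : ∀ S → let s = length (members S) in s * s < suc m →
                 ∃ λ i → ¬ Clash (NearΓ i) S
    clash-free S s²<L = ¬∀⟶∃¬ _ _ (clashΓ? S) λ clash →
      let pos  = λ i → let (u , v , u∈ , v∈ , _) = clash i in
                   index (∈-members {S = S} u∈) , index (∈-members {S = S} v∈)
          code = λ i → combine (proj₁ (pos i)) (proj₂ (pos i))
          (i , j , i<j , eq)     = pigeonhole s²<L code
          (eqᵘ , eqᵛ)            = combine-injective _ _ _ _ eq
          (u , v , u∈ , v∈ , u≢v , nrᵢ)  = clash i
          (u′ , v′ , u′∈ , v′∈ , _ , nrⱼ) = clash j
          at≡ = λ {x y} (x∈ : lookup S x ≡ true) (y∈ : lookup S y ≡ true) eq →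
                  trans (lookup-index (∈-members {S = S} x∈))
                    (trans (cong (List.lookup (members S)) eq)
                      (sym (lookup-index (∈-members {S = S} y∈))))
      in u≢v (apart (<⇒≢ i<j) nrᵢ
           (subst₂ (NearΓ j) (sym (at≡ u∈ u′∈ eqᵘ)) (sym (at≡ v∈ v′∈ eqᵛ)) nrⱼ))

    switch-≅ : ∀ S → let s = length (members S) in s * s < suc m →
               (Γ [ S ]) ≅ (Δ [ switch S ])
    switch-≅ S s²<L = induced-≅ {Γ} {Δ} (ψ i) S (switch S) (lookup-image i S) λ {u} {v} u∈ v∈ →
      adjacent u v u∈ v∈
      where
      i = firstFalse (clashesΓ S)

      -- `clash-free` provides a false entry somewhere, so the entry found at `i` is false and not
      -- the default.
      free : ¬ Clash (NearΓ i) S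
      free clash = contradiction
        (trans (sym (dec-true (clashΓ? S i) clash))
          (trans (sym (lookup∘tabulate (λ j → does (clashΓ? S j)) i))
            (let (j , ¬clash) = clash-free S s²<L in
             firstFalse-false (clashesΓ S) {j}
               (trans (lookup∘tabulate (λ j → does (clashΓ? S j)) j)
                 (dec-false (clashΓ? S j) ¬clash)))))
        λ ()

      adjacent : ∀ u v → lookup S u ≡ true → lookup S v ≡ true →
                 Adj Γ u v ⇔ Adj Δ (ψ.to i u) (ψ.to i v)
      -- A vertex may be near itself, where `adj` says nothing; equal vertices are settled by
      -- irreflexivity.
      adjacent u v u∈ v∈ with u ≟ v
      ... | yes refl = mk⇔ (λ a → contradiction a (Adj-irrefl Γ refl))
                           (λ a → contradiction a (Adj-irrefl Δ refl))
      ... | no u≢v = adj i λ nr → free (u , v , u∈ , v∈ , u≢v , nr)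

  #induced-≤ : ∀ H → order H * order H < suc m → #induced H Γ ≤ #induced H Δ
  #induced-≤ H h²<L =
    length-≤ (filter⁺ (λ S → Γ [ S ] ≅? H) (subsets! (order Γ)))
             (filter⁺ (λ T → Δ [ T ] ≅? H) (subsets! (order Δ)))
             switch (λ {S} S∈ →
               let iso = proj₂ (∈-filter⁻ (λ S → Γ [ S ] ≅? H) {xs = subsets _} S∈) in
               ∈-filter⁺ (λ T → Δ [ T ] ≅? H) (∈-subsets (switch S))
                 (≅-trans {Δ [ switch S ]} {Γ [ S ]} {H}
                   (≅-sym {Γ [ S ]} {Δ [ switch S ]} (switch-≅ S
                     -- A copy of `H` has as many members as `H` has vertices.
                     (subst (λ s → s * s < suc m) (sym (↔⇒≡ (proj₁ iso))) h²<L))) iso))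
             unswitch (λ _ → unswitch-switch _)

-- Transpositions of two colours.

transpose-atʳ : ∀ {n} (i j : Fin n) → transpose i j j ≡ i
transpose-atʳ i j with j ≟ i
... | yes refl = refl
... | no _ rewrite dec-true (j ≟ j) refl = refl

transpose-atˡ : ∀ {n} (i j : Fin n) → transpose i j i ≡ j
transpose-atˡ i j rewrite dec-true (i ≟ i) refl = refl

transpose-involutive : ∀ {n} (i j k : Fin n) → transpose i j (transpose i j k) ≡ k
transpose-involutive i j k with k ≟ i
... | yes refl = transpose-atʳ k j
... | no k≢i with k ≟ j
...   | yes refl = transpose-atˡ i k
...   | no k≢j rewrite dec-false (k ≟ i) k≢i | dec-false (k ≟ j) k≢j = refl

-- The two graphs.

Node : ℕ → Set
Node L = Maybe (Fin L × Fin 3)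

pattern hub    = nothing
pattern root i = just (i , 0F)
pattern mid i  = just (i , 1F)
pattern leaf i = just (i , 2F)

Vertex : ℕ → Set
Vertex L = Vec Bool L × Node L

parity : ∀ {L} → Vec Bool L → Bool
parity []      = false
parity (b ∷ y) = b xor parity y

-- In component y, gadget i is a path on root i, mid i and leaf i, centred at
-- mid i or at root i according to the i-th bit of y.
data Edge {L} (p : Bool) (y : Vec Bool L) : Node L → Node L → Set where
  hub-root  : ∀ {i} → Edge p y hub (root i)
  root-root : ∀ {i j} → i ≢ j → parity y ≡ p → Edge p y (root i) (root j)
  root-mid  : ∀ {i} → Edge p y (root i) (mid i)
  mid-leaf  : ∀ {i} → lookup y i ≡ false → Edge p y (mid i) (leaf i)
  root-leaf : ∀ {i} → lookup y i ≡ true → Edge p y (root i) (leaf i)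

edge? : ∀ {L} p (y : Vec Bool L) m n → Dec (Edge p y m n)
edge? p y hub hub = no λ ()
edge? p y hub (root i) = yes hub-root
edge? p y hub (mid i) = no λ ()
edge? p y hub (leaf i) = no λ ()
edge? p y (root i) hub = no λ ()
edge? p y (root i) (root j) =
  map′ (λ (i≢j , eq) → root-root i≢j eq) (λ { (root-root i≢j eq) → i≢j , eq })
    (¬? (i ≟ j) ×-dec parity y ≟ᵇ p)
edge? p y (root i) (mid j) = map′ (λ { refl → root-mid }) (λ { root-mid → refl }) (i ≟ j)
edge? p y (root i) (leaf j) =
  map′ (λ { (refl , eq) → root-leaf eq }) (λ { (root-leaf eq) → refl , eq })
    (i ≟ j ×-dec lookup y i ≟ᵇ true)
edge? p y (mid i) hub = no λ ()
edge? p y (mid i) (root j) = no λ ()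
edge? p y (mid i) (mid j) = no λ ()
edge? p y (mid i) (leaf j) =
  map′ (λ { (refl , eq) → mid-leaf eq }) (λ { (mid-leaf eq) → refl , eq })
    (i ≟ j ×-dec lookup y i ≟ᵇ false)
edge? p y (leaf i) hub = no λ ()
edge? p y (leaf i) (root j) = no λ ()
edge? p y (leaf i) (mid j) = no λ ()
edge? p y (leaf i) (leaf j) = no λ ()

-- `Edge` gives every edge outside the cliques one orientation only, hence the sum.
Linked : ∀ {L} → Bool → Vertex L → Vertex L → Set
Linked p (y , m) (z , n) = y ≡ z × (Edge p y m n ⊎ Edge p y n m)

linked? : ∀ {L} p (u v : Vertex L) → Dec (Linked p u v)
linked? p (y , m) (z , n) = ≡-dec _≟ᵇ_ y z ×-dec (edge? p y m n ⊎-dec edge? p y n m)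

linked-sym : ∀ {L p} {u v : Vertex L} → Linked p u v → Linked p v u
linked-sym (refl , e) = refl , swap e

linked-irrefl : ∀ {L p} {v : Vertex L} → ¬ Linked p v v
linked-irrefl (_ , inj₁ (root-root i≢i _)) = i≢i refl
linked-irrefl (_ , inj₂ (root-root i≢i _)) = i≢i refl

-- Numbering the vertices.

nodes : ∀ L → List (Node L)
nodes L = nothing ∷ List.map just (cartesianProduct (allFin L) (allFin 3))

nodes! : ∀ L → Unique (nodes L)
nodes! L = All.map⁺ (All.universal (λ _ ()) _) AllPairs.∷
  map⁺ just-injective (cartesianProduct⁺ (allFin⁺ L) (allFin⁺ 3))

∈-nodes : ∀ {L} (n : Node L) → n ∈ nodes L
∈-nodes nothing        = here refl
∈-nodes (just (i , s)) =
  there (∈-map⁺ just (∈-cartesianProduct⁺ (∈-allFin i) (∈-allFin s)))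

vertices : ∀ L → List (Vertex L)
vertices L = cartesianProduct (subsets L) (nodes L)

vertices! : ∀ L → Unique (vertices L)
vertices! L = cartesianProduct⁺ (subsets! L) (nodes! L)

∈-vertices : ∀ {L} (v : Vertex L) → v ∈ vertices L
∈-vertices (y , n) = ∈-cartesianProduct⁺ (∈-subsets y) (∈-nodes n)

size : ℕ → ℕ
size L = length (vertices L)

enc : ∀ {L} → Vertex L → Fin (size L)
enc v = index (∈-vertices v)

dec : ∀ {L} → Fin (size L) → Vertex L
dec {L} = List.lookup (vertices L)

dec-enc : ∀ {L} (v : Vertex L) → dec (enc v) ≡ v
dec-enc v = sym (lookup-index (∈-vertices v))

enc-dec : ∀ {L} (j : Fin (size L)) → enc (dec {L} j) ≡ j
enc-dec {L} j = lookup-injective (vertices! L) (dec-enc (dec j))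

twist : ℕ → Bool → Graph
twist L p = record
  { order      = size L
  ; Adj        = λ u v → Linked p (dec {L} u) (dec {L} v)
  ; Adj?       = λ u v → linked? p (dec u) (dec v)
  ; Adj-sym    = linked-sym
  ; Adj-irrefl = λ { refl → linked-irrefl {p = p} }
  }

-- Bit flips and recolouring at one gadget.

flip : ∀ {L} → Fin L → Vec Bool L → Vec Bool L
flip i y = updateAt y i not

flip-flip : ∀ {L} (i : Fin L) y → flip i (flip i y) ≡ y
flip-flip i y = trans (updateAt-updateAt i y) (updateAt-id-local i y (not-involutive _))

-- Hence flipping one bit carries the components with a clique in one graph to those with a clique
-- in the other.
parity-flip : ∀ {L} (i : Fin L) y → parity (flip i y) ≡ not (parity y)
parity-flip zero    (false ∷ y) = refl
parity-flip zero    (true ∷ y)  = sym (not-involutive _)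
parity-flip (suc i) (false ∷ y) = parity-flip i y
parity-flip (suc i) (true ∷ y)  = cong not (parity-flip i y)

Within : ∀ {L} → Fin L → Node L → Set
Within i nothing        = ⊥
Within i (just (j , _)) = i ≡ j

within? : ∀ {L} (i : Fin L) n → Dec (Within i n)
within? i nothing        = no λ ()
within? i (just (j , _)) = i ≟ j

module _ {L k : ℕ} where

  Colouring : Set
  Colouring = Vertex L → Fin k

  AgreeOutside : Fin L → Colouring → Colouring → Set
  AgreeOutside i f g = ∀ y n → ¬ Within i n → f (y , n) ≡ g (y , n)

  AgreeInside : Fin L → Colouring → Colouring → Set
  AgreeInside i f g = ∀ y n → Within i n → f (y , n) ≡ g (y , n)

  ProperOn : Bool → Colouring → Set
  ProperOn p f = ∀ {y m n} → Edge p y m n → f (y , m) ≢ f (y , n)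

  -- A leaf avoiding the colour of mid i is turned into one avoiding the colour
  -- of root i by transposing these two colours, and conversely.
  recolour : Fin L → Colouring → Colouring
  recolour i f (y , leaf j) =
    if does (i ≟ j)
    then transpose (f (flip i y , root i)) (f (flip i y , mid i)) (f (flip i y , leaf i))
    else f (flip i y , leaf j)
  recolour i f (y , n) = f (flip i y , n)

  recolour-outside : ∀ i f y n → ¬ Within i n → recolour i f (y , n) ≡ f (flip i y , n)
  recolour-outside i f y hub      _   = refl
  recolour-outside i f y (root j) _   = refl
  recolour-outside i f y (mid j)  _   = refl
  recolour-outside i f y (leaf j) i≢j rewrite dec-false (i ≟ j) i≢j = refl

  recolour-leaf : ∀ i f y → recolour i f (y , leaf i) ≡
    transpose (f (flip i y , root i)) (f (flip i y , mid i)) (f (flip i y , leaf i))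
  recolour-leaf i f y rewrite dec-true (i ≟ i) refl = refl

  -- The repaired leaf depends on the colours of root, mid and leaf, all in gadget `i`; the repair
  -- reads nothing outside it.
  recolour-inside : ∀ i {f g} → AgreeInside i f g → AgreeInside i (recolour i f) (recolour i g)
  recolour-inside i {f} {g} f≗g y (root j) i≡j  = f≗g _ (root j) i≡j
  recolour-inside i {f} {g} f≗g y (mid j)  i≡j  = f≗g _ (mid j) i≡j
  recolour-inside i {f} {g} f≗g y (leaf j) refl
    rewrite recolour-leaf i f y | recolour-leaf i g y
          | f≗g (flip i y) (root i) refl | f≗g (flip i y) (mid i) refl
          | f≗g (flip i y) (leaf i) refl = refl

  disjoint : ∀ {i j : Fin L} → i ≢ j → ∀ n → Within i n → ¬ Within j n
  disjoint i≢j (just _) refl refl = i≢j refl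

  -- Outside gadget `i` colours only move between components. A node in gadget `i` but not in gadget
  -- `j` forces `i ≢ j`, so `f` and `g` agree on all of gadget `i`, which determines the new colours
  -- there.
  recolour-agree : ∀ i j {f g} → AgreeOutside j f g → AgreeOutside j (recolour i f) (recolour i g)
  recolour-agree i j {f} {g} f≗g y n n∉j with within? i n
  ... | no n∉i = trans (recolour-outside i f y n n∉i)
                   (trans (f≗g _ n n∉j) (sym (recolour-outside i g y n n∉i)))
  ... | yes n∈i = recolour-inside i {f} {g}
        (λ z m m∈i → f≗g z m (disjoint (λ { refl → n∉j n∈i }) m m∈i)) y n n∈i

  recolour-cong : ∀ i {f g} → (∀ v → f v ≡ g v) → ∀ v → recolour i f v ≡ recolour i g v
  recolour-cong i {f} {g} f≗g (y , n) with within? i n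
  ... | no n∉i = trans (recolour-outside i f y n n∉i)
                   (trans (f≗g _) (sym (recolour-outside i g y n n∉i)))
  ... | yes n∈i = recolour-inside i {f} {g} (λ z m _ → f≗g (z , m)) y n n∈i

  -- The colours of root and mid are moved unchanged, so the second pass applies the same
  -- transposition to the leaf.
  recolour-involutive : ∀ i f v → recolour i (recolour i f) v ≡ f v
  recolour-involutive i f (y , n) with within? i n
  ... | no n∉i = trans (recolour-outside i (recolour i f) y n n∉i)
                   (trans (recolour-outside i f (flip i y) n n∉i)
                     (cong (λ z → f (z , n)) (flip-flip i y)))
  recolour-involutive i f (y , root j) | yes _ = cong (λ z → f (z , root j)) (flip-flip i y)
  recolour-involutive i f (y , mid j)  | yes _ = cong (λ z → f (z , mid j)) (flip-flip i y)
  recolour-involutive i f (y , leaf j) | yes refl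
    rewrite recolour-leaf i (recolour i f) y | recolour-leaf i f (flip i y) | flip-flip i y
    = transpose-involutive (f (y , root i)) (f (y , mid i)) (f (y , leaf i))

  -- The change of parity takes care of the clique edges, and no other edge depends on bit `i`
  -- except the one at `leaf i`, which the transposition handles.
  recolour-proper : ∀ i f {p q} → q ≡ not p → ProperOn p f → ProperOn q (recolour i f)
  recolour-proper i f q≡ pf hub-root = pf hub-root
  recolour-proper i f {p} q≡ pf {y} (root-root j≢k eq) = pf (root-root j≢k
    (trans (parity-flip i y) (trans (cong not (trans eq q≡)) (not-involutive p))))
  recolour-proper i f q≡ pf root-mid = pf root-mid
  recolour-proper i f q≡ pf {y} (mid-leaf {j} yⱼ) eq with i ≟ j
  ... | no i≢j = pf (mid-leaf (trans (lookup∘updateAt′ j i (i≢j ∘ sym) y) yⱼ)) eq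
  -- If the new leaf had the colour of mid, undoing the transposition would give the old leaf the
  -- colour of root, its old neighbour. The case of `root-leaf` is symmetric.
  ... | yes refl = pf (root-leaf (trans (lookup∘updateAt i y) (cong not yⱼ)))
      (trans (sym (transpose-atʳ r m)) (trans (cong (transpose r m) eq)
        (transpose-involutive r m _)))
    where
    r = f (flip i y , root i)
    m = f (flip i y , mid i)
  recolour-proper i f q≡ pf {y} (root-leaf {j} yⱼ) eq with i ≟ j
  ... | no i≢j = pf (root-leaf (trans (lookup∘updateAt′ j i (i≢j ∘ sym) y) yⱼ)) eq
  ... | yes refl = pf (mid-leaf (trans (lookup∘updateAt i y) (cong not yⱼ)))
      (trans (sym (transpose-atˡ r m)) (trans (cong (transpose r m) eq)
        (transpose-involutive r m _)))
    where
    r = f (flip i y , root i)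
    m = f (flip i y , mid i)

  -- Recolouring vectors of colours.

  at : Vec (Fin k) (size L) → Colouring
  at c v = lookup c (enc v)

  at-injective : ∀ {c d} → (∀ v → at c v ≡ at d v) → c ≡ d
  at-injective {c} {d} eq = begin
    c                   ≡⟨ tabulate∘lookup c ⟨
    tabulate (lookup c) ≡⟨ tabulate-cong (λ j → subst (λ j → lookup c j ≡ lookup d j)
                             (enc-dec j) (eq (dec j))) ⟩
    tabulate (lookup d) ≡⟨ tabulate∘lookup d ⟩
    d                   ∎
    where open ≡-Reasoning

  at-dec : ∀ c j → at c (dec j) ≡ lookup c j
  at-dec c j = cong (lookup c) (enc-dec j)

  proper⇒properOn : ∀ {p c} → Proper (twist L p) c → ProperOn p (at c)
  proper⇒properOn {p} {c} pr {y} {m} {n} e = pr _ _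
    (subst₂ (Linked p) (sym (dec-enc (y , m))) (sym (dec-enc (y , n))) (refl , inj₁ e))

  properOn⇒proper : ∀ {p c} → ProperOn p (at c) → Proper (twist L p) c
  properOn⇒proper {p} {c} pr u v linked eq =
    apart (dec u) (dec v) linked (trans (at-dec c u) (trans eq (sym (at-dec c v))))
    where
    apart : ∀ x z → Linked p x z → at c x ≢ at c z
    apart x z (refl , inj₁ e) = pr e
    apart x z (refl , inj₂ e) = pr e ∘ sym

  recolourᵛ : Fin L → Vec (Fin k) (size L) → Vec (Fin k) (size L)
  recolourᵛ i c = tabulate λ j → recolour i (at c) (dec j)

  at-recolourᵛ : ∀ i c v → at (recolourᵛ i c) v ≡ recolour i (at c) v
  at-recolourᵛ i c v = trans (lookup∘tabulate _ (enc v)) (cong (recolour i (at c)) (dec-enc v))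

  recolourᵛ-involutive : ∀ i c → recolourᵛ i (recolourᵛ i c) ≡ c
  recolourᵛ-involutive i c = at-injective λ v → trans (at-recolourᵛ i (recolourᵛ i c) v)
    (trans (recolour-cong i (at-recolourᵛ i c) v) (recolour-involutive i (at c) v))

  recolourᵛ-proper : ∀ i c {p q} → q ≡ not p → Proper (twist L p) c →
                     Proper (twist L q) (recolourᵛ i c)
  recolourᵛ-proper i c {p} {q} q≡ pr = properOn⇒proper {c = recolourᵛ i c} λ e eq →
    recolour-proper i (at c) q≡ (proper⇒properOn {c = c} pr) e
      (trans (sym (at-recolourᵛ i c _)) (trans eq (at-recolourᵛ i c _)))

  Nearᵛ : Fin L → Vec (Fin k) (size L) → Vec (Fin k) (size L) → Set
  Nearᵛ i c d = AgreeOutside i (at c) (at d)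

  nearᵛ? : ∀ i c d → Dec (Nearᵛ i c d)
  nearᵛ? i c d = map′
    (λ agree y n → subst (λ v → ¬ Within i (proj₂ v) → at c v ≡ at d v)
                     (dec-enc (y , n)) (agree (enc (y , n))))
    (λ agree j → agree (proj₁ (dec j)) (proj₂ (dec j)))
    (all? λ j → ¬? (within? i (proj₂ (dec j))) →-dec (at c (dec j) ≟ at d (dec j)))

  recolourᵛ-near : ∀ i j {c d} → Nearᵛ j c d → Nearᵛ j (recolourᵛ i c) (recolourᵛ i d)
  recolourᵛ-near i j {c} {d} nr y n n∉j = trans (at-recolourᵛ i c (y , n))
    (trans (recolour-agree i j nr y n n∉j) (sym (at-recolourᵛ i d (y , n))))

  recolourᵛ-near⁻ : ∀ i j {c d} → Nearᵛ j (recolourᵛ i c) (recolourᵛ i d) → Nearᵛ j c d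
  recolourᵛ-near⁻ i j {c} {d} nr = subst₂ (Nearᵛ j)
    (recolourᵛ-involutive i c) (recolourᵛ-involutive i d)
    (recolourᵛ-near i j {recolourᵛ i c} {recolourᵛ i d} nr)

  -- Gadgets are disjoint, so every node lies outside gadget `i` or outside gadget `j`.
  near-apart : ∀ {i j c d} → i ≢ j → Nearᵛ i c d → Nearᵛ j c d → c ≡ d
  near-apart {i} {j} {c} {d} i≢j nrᵢ nrⱼ = at-injective λ (y , n) → agree y n
    where
    agree : ∀ y n → at c (y , n) ≡ at d (y , n)
    agree y n with within? i n
    ... | no n∉i  = nrᵢ y n n∉i
    ... | yes n∈i = nrⱼ y n (disjoint i≢j n n∈i)

  -- A single difference inside gadget `i` would make the colourings near, so it lies outside and
  -- just moves to the flipped component. Inside gadget `i` the colourings agree, hence so do their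
  -- repairs; a difference at root or mid could have changed the transposition and with it the leaf.
  recolourᵛ-differ : ∀ i {c d} → ¬ Nearᵛ i c d → DifferAtOne c d →
                     DifferAtOne (recolourᵛ i c) (recolourᵛ i d)
  recolourᵛ-differ i {c} {d} ¬near (j , c≢d , unique) =
    enc (flip i y , n) ,
    (λ eq → c≢d (trans (sym (value c)) (trans eq (value d)))) ,
    λ {w} → unique′ w
    where
    y = proj₁ (dec j)
    n = proj₂ (dec j)

    only : ∀ v → at c v ≢ at d v → dec j ≡ v
    only v ne = trans (cong dec (unique ne)) (dec-enc v)

    n∉i : ¬ Within i n
    n∉i n∈i = ¬near λ z m m∉i → decidable-stable (_ ≟ _) λ ne →
      m∉i (subst (Within i ∘ proj₂) (only (z , m) ne) n∈i)

    inside : AgreeInside i (at c) (at d)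
    inside z m m∈i = decidable-stable (_ ≟ _) λ ne →
      n∉i (subst (Within i ∘ proj₂) (sym (only (z , m) ne)) m∈i)

    value : ∀ e → at (recolourᵛ i e) (flip i y , n) ≡ lookup e j
    value e = trans (at-recolourᵛ i e _) (trans (recolour-outside i (at e) _ n n∉i)
      (trans (cong (λ z → at e (z , n)) (flip-flip i y)) (at-dec e j)))

    unique′ : ∀ w → lookup (recolourᵛ i c) w ≢ lookup (recolourᵛ i d) w → enc (flip i y , n) ≡ w
    unique′ w ne with within? i (proj₂ (dec w))
    ... | yes m∈i = contradiction
          (trans (lookup∘tabulate _ w) (trans (recolour-inside i inside _ _ m∈i)
            (sym (lookup∘tabulate _ w)))) ne
    ... | no m∉i = trans (cong enc flipped) (enc-dec w)
      where
      z = proj₁ (dec w)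
      m = proj₂ (dec w)
      -- A difference at `w` after recolouring comes from one at the flipped component before, and
      -- there is only one such.
      source : dec j ≡ (flip i z , m)
      source = only (flip i z , m) λ eq → ne
        (trans (lookup∘tabulate _ w) (trans (recolour-outside i (at c) z m m∉i)
          (trans eq (sym (trans (lookup∘tabulate _ w) (recolour-outside i (at d) z m m∉i))))))
      flipped : (flip i y , n) ≡ dec w
      flipped = trans (cong (λ v → flip i (proj₁ v) , proj₂ v) source)
                  (cong (_, m) (flip-flip i z))

  recolourᵛ-differ⁻ : ∀ i {c d} → ¬ Nearᵛ i c d →
                      DifferAtOne (recolourᵛ i c) (recolourᵛ i d) → DifferAtOne c d
  recolourᵛ-differ⁻ i {c} {d} ¬near df = subst₂ DifferAtOne
    (recolourᵛ-involutive i c) (recolourᵛ-involutive i d)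
    (recolourᵛ-differ i {recolourᵛ i c} {recolourᵛ i d} (¬near ∘ recolourᵛ-near⁻ i i {c} {d}) df)

-- The switching between the two colouring graphs.

module _ (L k : ℕ) where

  private
    X : ∀ p → List (Vec (Fin k) (size L))
    X p = colourings (twist L p) k

    X! : ∀ p → Unique (X p)
    X! p = filter⁺ (proper? (twist L p)) (vecs-unique (allFin⁺ k) (size L))

    recolour-∈ : ∀ i {p q} → q ≡ not p → ∀ {c} → c ∈ X p → recolourᵛ {L} i c ∈ X q
    recolour-∈ i {p} {q} q≡ {c} c∈ = ∈-filter⁺ (proper? (twist L q))
      (vecs-complete ∈-allFin (recolourᵛ {L} i c))
      (recolourᵛ-proper {L} i c q≡ (proj₂
        (∈-filter⁻ (proper? (twist L p)) {xs = vecs (allFin k) (size L)} c∈)))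

    colouring : ∀ p → V (𝒞 k (twist L p)) → Vec (Fin k) (size L)
    colouring p = List.lookup (X p)

  -- The second parity is a variable with an equation because the inverse bijection is the same map
  -- with `p` and `q` exchanged, and `not (not p)` does not reduce to `p`.
  switching : ∀ {p q} → q ≡ not p → Switching L (𝒞 k (twist L p)) (𝒞 k (twist L q))
  switching {p} {q} q≡ = record
    { ψ      = λ i → proj₁ (correspondence i)
    ; NearΓ  = λ i u v → Nearᵛ {L} i (colouring p u) (colouring p v)
    ; NearΔ  = λ i u v → Nearᵛ {L} i (colouring q u) (colouring q v)
    ; nearΓ? = λ i u v → nearᵛ? {L} i (colouring p u) (colouring p v)
    ; nearΔ? = λ i u v → nearᵛ? {L} i (colouring q u) (colouring q v)
    ; near   = λ i j u v → recoloured i u v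
                 (λ c d c′ d′ → Nearᵛ {L} j c d ⇔ Nearᵛ {L} j c′ d′)
                 (λ c d → mk⇔ (recolourᵛ-near {L} i j {c} {d}) (recolourᵛ-near⁻ {L} i j {c} {d}))
    ; apart  = λ {_} {_} {u} {v} i≢j nrᵢ nrⱼ → lookup-injective (X! p)
                 (near-apart {L} {c = colouring p u} {d = colouring p v} i≢j nrᵢ nrⱼ)
    ; adj    = λ i {u} {v} → recoloured i u v
                 (λ c d c′ d′ → ¬ Nearᵛ {L} i c d → DifferAtOne c d ⇔ DifferAtOne c′ d′)
                 (λ c d ¬near → mk⇔ (recolourᵛ-differ {L} i {c} {d} ¬near)
                                    (recolourᵛ-differ⁻ {L} i {c} {d} ¬near))
    }
    where
    correspondence : ∀ i → Σ[ ψ ∈ V (𝒞 k (twist L p)) ↔ V (𝒞 k (twist L q)) ]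
      (∀ u → colouring q (Inverse.to ψ u) ≡ recolourᵛ {L} i (colouring p u))
    correspondence i = lookup-↔ (X! p) (X! q)
      (recolourᵛ {L} i) (recolour-∈ i q≡)
      (recolourᵛ {L} i) (recolour-∈ i (trans (sym (not-involutive p)) (cong not (sym q≡))))
      (λ _ → recolourᵛ-involutive {L} i _) (λ _ → recolourᵛ-involutive {L} i _)

    recoloured : ∀ i u v (P : (c d c′ d′ : Vec (Fin k) (size L)) → Set) →
      (∀ c d → P c d (recolourᵛ {L} i c) (recolourᵛ {L} i d)) →
      let (ψ , _) = correspondence i in
      P (colouring p u) (colouring p v)
        (colouring q (Inverse.to ψ u)) (colouring q (Inverse.to ψ v))
    recoloured i u v P holds = let (_ , ψ≡) = correspondence i in
      subst₂ (P (colouring p u) (colouring p v)) (sym (ψ≡ u)) (sym (ψ≡ v)) (holds _ _)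

-- Negating the parity twice returns the first graph, so one inequality serves in both directions.
π-twist : ∀ {m} p H k → order H * order H < suc m →
          π H (twist (suc m) p) k ≡ π H (twist (suc m) (not p)) k
π-twist {m} p H k h²<L = ≤-antisym (π-≤ p (not p) refl) (π-≤ (not p) p (sym (not-involutive p)))
  where
  π-≤ : ∀ p q → q ≡ not p → π H (twist (suc m) p) k ≤ π H (twist (suc m) q) k
  π-≤ p q q≡ = #induced-≤ {Γ = 𝒞 k (twist (suc m) p)} {Δ = 𝒞 k (twist (suc m) q)}
    (switching (suc m) k {p} {q} q≡) H h²<L

-- Non-isomorphism of the two graphs.

-- This property separates the two graphs: the only vertex violating it is the
-- hub of the all-ones component, when that component has no clique on its roots.
LongWalks : {A : Set} → (A → A → Set) → Set
LongWalks R = ∀ v → ∃ λ a → ∃₂ λ b c → R v a × R a b × R b c × b ≢ v × c ≢ a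

longWalks-↔ : {A B : Set} {R : A → A → Set} {Q : B → B → Set} (φ : A ↔ B) →
              (∀ u v → R u v ⇔ Q (Inverse.to φ u) (Inverse.to φ v)) →
              LongWalks R → LongWalks Q
longWalks-↔ {R = R} {Q} φ adj walks v =
  let (a , b , c , va , ab , bc , b≢v , c≢a) = walks (φ.from v) in
  φ.to a , φ.to b , φ.to c ,
  subst (λ x → Q x (φ.to a)) (φ.strictlyInverseˡ v) (Equivalence.to (adj _ _) va) ,
  Equivalence.to (adj _ _) ab , Equivalence.to (adj _ _) bc ,
  (λ eq → b≢v (trans (sym (φ.strictlyInverseʳ b)) (cong φ.from eq))) ,
  (λ eq → c≢a (trans (sym (φ.strictlyInverseʳ c)) (trans (cong φ.from eq) (φ.strictlyInverseʳ a))))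
  where module φ = Inverse φ

another : ∀ {m} (i : Fin (suc (suc m))) → ∃ λ j → i ≢ j
another zero    = suc zero , λ ()
another (suc i) = zero , λ ()

zero-bit : ∀ {n} (y : Vec Bool n) → y ≢ replicate n true → ∃ λ i → lookup y i ≡ false
zero-bit []          y≢ = contradiction refl y≢
zero-bit (false ∷ y) y≢ = zero , refl
zero-bit (true ∷ y)  y≢ = let (i , eq) = zero-bit y (y≢ ∘ cong (true ∷_)) in suc i , eq

module _ (m : ℕ) where
  private
    L : ℕ
    -- With at least two gadgets, a walk can always pass through the hub into `another` one.
    L = suc (suc m)

    ones : Vec Bool L
    ones = replicate L true

  -- The parity of `ones` depends on `L`; the sign records whether the all-ones component has the
  -- clique.
  twist⁺ twist⁻ : Graph
  twist⁺ = twist L (parity ones)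
  twist⁻ = twist L (not (parity ones))

  -- From a hub the walk is a triangle through the clique or, since a component of the other parity
  -- has a zero bit, runs down a gadget rooted at its end. From elsewhere it leads to the hub and,
  -- if steps remain, into another gadget.
  linked-longWalks : LongWalks (Linked {L} (parity ones))
  linked-longWalks (y , hub) with parity y ≟ᵇ parity ones
  ... | yes eq = (y , root zero) , (y , root (suc zero)) , (y , hub) ,
        (refl , inj₁ hub-root) , (refl , inj₁ (root-root (λ ()) eq)) , (refl , inj₂ hub-root) ,
        (λ ()) , (λ ())
  ... | no ne = let (i , yᵢ) = zero-bit y (λ eq → ne (cong parity eq)) in
        (y , root i) , (y , mid i) , (y , leaf i) ,
        (refl , inj₁ hub-root) , (refl , inj₁ root-mid) , (refl , inj₁ (mid-leaf yᵢ)) ,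
        (λ ()) , (λ ())
  linked-longWalks (y , root i) with j , i≢j ← another i =
    (y , hub) , (y , root j) , (y , mid j) ,
    (refl , inj₂ hub-root) , (refl , inj₁ hub-root) , (refl , inj₁ root-mid) ,
    (λ { refl → i≢j refl }) , (λ ())
  linked-longWalks (y , mid i) with j , i≢j ← another i =
    (y , root i) , (y , hub) , (y , root j) ,
    (refl , inj₂ root-mid) , (refl , inj₂ hub-root) , (refl , inj₁ hub-root) ,
    (λ ()) , (λ { refl → i≢j refl })
  linked-longWalks (y , leaf i) with lookup y i in yᵢ
  ... | true with j , i≢j ← another i =
    (y , root i) , (y , hub) , (y , root j) ,
    (refl , inj₂ (root-leaf yᵢ)) , (refl , inj₂ hub-root) , (refl , inj₁ hub-root) ,
    (λ ()) , (λ { refl → i≢j refl })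
  ... | false =
    (y , mid i) , (y , root i) , (y , hub) ,
    (refl , inj₂ (mid-leaf yᵢ)) , (refl , inj₂ root-mid) , (refl , inj₂ hub-root) ,
    (λ ()) , (λ ())

  -- With all bits one, `mid i` and `leaf i` are pendant at `root i`. Without the clique the
  -- component is a tree of depth two below the hub, so a third step must backtrack.
  ¬linked-longWalks : ¬ LongWalks (Linked {L} (not (parity ones)))
  ¬linked-longWalks walks with walks (ones , hub)
  ... | (_ , root i) , _ , _ , (refl , inj₁ hub-root) , (refl , inj₂ hub-root) , _ , b≢v , _ =
    b≢v refl
  ... | (_ , root i) , _ , _ , (refl , inj₁ hub-root) , (refl , inj₁ (root-root _ eq)) , _ =
    not-¬ refl eq
  ... | (_ , root i) , _ , _ , (refl , inj₁ hub-root) , (refl , inj₂ (root-root _ eq)) , _ =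
    not-¬ refl eq
  ... | (_ , root i) , _ , _ , (refl , inj₁ hub-root) , (refl , inj₁ root-mid) ,
        (refl , inj₁ (mid-leaf eq)) , _ =
    contradiction (trans (sym (lookup-replicate i true)) eq) λ ()
  ... | (_ , root i) , _ , _ , (refl , inj₁ hub-root) , (refl , inj₁ root-mid) ,
        (refl , inj₂ root-mid) , _ , c≢a =
    c≢a refl
  ... | (_ , root i) , _ , _ , (refl , inj₁ hub-root) , (refl , inj₁ (root-leaf _)) ,
        (refl , inj₂ (mid-leaf eq)) , _ =
    contradiction (trans (sym (lookup-replicate i true)) eq) λ ()
  ... | (_ , root i) , _ , _ , (refl , inj₁ hub-root) , (refl , inj₁ (root-leaf _)) ,
        (refl , inj₂ (root-leaf _)) , _ , c≢a =
    c≢a refl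

  twist-≇ : ¬ (twist⁺ ≅ twist⁻)
  twist-≇ (φ , adj) = ¬linked-longWalks
    (longWalks-↔ {R = Adj twist⁻} {Q = Linked (not (parity ones))}
      (mk↔ₛ′ (dec {L}) enc dec-enc enc-dec) (λ u v → mk⇔ id id)
      (longWalks-↔ {R = Adj twist⁺} {Q = Adj twist⁻} φ adj
        (longWalks-↔ {R = Linked (parity ones)} {Q = Adj twist⁺}
          (mk↔ₛ′ (enc {L}) dec enc-dec dec-enc)
          (λ u v → subst₂ (λ x z → Linked (parity ones) u v ⇔ Linked (parity ones) x z)
            (sym (dec-enc u)) (sym (dec-enc v)) (mk⇔ id id))
          linked-longWalks)))

  π-twist± : ∀ H k → order H * order H < L → π H twist⁺ k ≡ π H twist⁻ k
  π-twist± = π-twist (parity ones)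

-- Choice of the number of gadgets.

max-order : ∀ t (H : Fin t → Graph) → ∃ λ h → ∀ i → order (H i) ≤ h
max-order zero    H = 0 , λ ()
max-order (suc t) H = let (h , bound) = max-order t (H ∘ suc) in
  order (H zero) ⊔ h ,
  λ { zero → m≤m⊔n _ h ; (suc i) → ≤-trans (bound i) (m≤n⊔m _ h) }

theorem5 : ∀ (t : ℕ) (H : Fin t → Graph) →
    ∃₂ λ (G G′ : Graph) →
    (¬ (G ≅ G′)) ×
    (∀ (i : Fin t) (k : ℕ) → .{{_ : NonZero k}} → π (H i) G k ≡ π (H i) G′ k)
-- This takes `h * h + 2` gadgets: more than the pairs in any copy of an `H i`, and never fewer than
-- two.
theorem5 t H = twist⁺ (h * h) , twist⁻ (h * h) , twist-≇ (h * h) , λ i k →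
  π-twist± (h * h) (H i) k (small i)
  where
  h : ℕ
  h = proj₁ (max-order t H)

  small : ∀ i → order (H i) * order (H i) < suc (suc (h * h))
  small i = s≤s (m≤n⇒m≤1+n (*-mono-≤ bound bound))
    where bound = proj₂ (max-order t H) i
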